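{- For every $k\ge 1$ and $n\ge k+2$ we have $\mathrm{av}_n^k(1324,2143)=2p(k)$, where $p(k)$ is the number of integer partitions of $k$.
   Context: $\mathrm{av}_n^k(B)$ is the number of permutations in $S_n$ with exactly $k$ inversions (pairs $i<j$ with $\pi_i>\pi_j$) that avoid every pattern in $B$; a permutation avoids a pattern $q$ if it has no subsequence order-isomorphic to $q$. -}

module Defs where

open import Data.Fin using (Fin; zero; suc; toℕ; _<_; punchIn)
open import Data.Fin.Patterns using (0F; 1F; 2F; 3F)
open import Data.Fin.Permutation
  using (Permutation′; _⟨$⟩ʳ_; _≈_; _∘ₚ_; id; insert; remove; transpose; insert-remove; insert-punchIn)
open import Data.Fin.Properties using (_<?_; any?; all?; punchIn-injective)
open import Data.List
  using (List; []; _∷_; length; filter; upTo; allFin; cartesianProduct; cartesianProductWith)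
open import Data.List.Membership.Propositional using (_∈_)
open import Data.List.Membership.Propositional.Properties
  using (∈-allFin; ∈-upTo⁺; ∈-filter⁺; ∈-cartesianProductWith⁺; ∈-cartesianProductWith⁻)
import Data.List.Membership.Setoid.Properties as SetoidMembershipₚ
open import Data.List.Properties using (∷-injective)
open import Data.List.Relation.Unary.All as All using (All; []; _∷_)
open import Data.List.Relation.Unary.AllPairs using (AllPairs; []; _∷_)
open import Data.List.Relation.Unary.Any using (Any; here; there)
open import Data.List.Relation.Unary.Linked as Linked using (Linked)
open import Data.List.Relation.Unary.Unique.Propositional using (Unique)
open import Data.List.Relation.Unary.Unique.Propositional.Properties
  using (allFin⁺; upTo⁺; filter⁺; cartesianProductWith⁺)
import Data.List.Relation.Unary.Unique.Setoid.Properties as SetoidUniqueₚ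
open import Data.Nat as ℕ using (ℕ; zero; suc; _≤_; _≥_; z≤n; s≤s)
open import Data.Nat.ListAction using (sum)
import Data.Nat.Properties as ℕ
open import Data.Product using (∃; _×_; _,_; proj₁; proj₂; uncurry; <_,_>)
open import Data.Vec as Vec using (Vec; []; _∷_; lookup)
open import Function.Base using (_∘_)
open import Function.Bundles using (_⇔_; mk⇔; module Equivalence)
open import Level using (0ℓ)
open import Relation.Binary.Bundles using (Setoid)
open import Relation.Binary.PropositionalEquality
  using (_≡_; refl; sym; trans; cong; subst; setoid; module ≡-Reasoning)
open import Relation.Nullary using (¬_; Dec)
open import Relation.Nullary.Decidable using (map′; ¬?; _×-dec_; _→-dec_)
open import Relation.Unary using (Pred; Decidable)

-- Entries are numbered from 0.  A permutation of Fin (suc n) is given by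
-- its first entry j together with the standardisation π of the remaining
-- ones.  The list contains each permutation exactly once up to pointwise
-- equality: see permutations-complete and permutations-unique.
permutations : ∀ n → List (Permutation′ n)
permutations zero    = id ∷ []
permutations (suc n) =
  cartesianProductWith (insert 0F) (allFin (suc n)) (permutations n)

≈-setoid : ℕ → Setoid 0ℓ 0ℓ
≈-setoid n = record
  { Carrier       = Permutation′ n
  ; _≈_           = _≈_
  ; isEquivalence = record
    { refl  = λ _ → refl
    ; sym   = λ eq i → sym (eq i)
    ; trans = λ eq₁ eq₂ i → trans (eq₁ i) (eq₂ i)
    }
  }

private
  insert-cong : ∀ {n} {i j : Fin (suc n)} {π ρ : Permutation′ n} →
                i ≡ j → π ≈ ρ → insert 0F i π ≈ insert 0F j ρ
  insert-cong refl eq zero    = refl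
  insert-cong {i = i} {π = π} {ρ = ρ} refl eq (suc k) = begin
    insert 0F i π ⟨$⟩ʳ suc k  ≡⟨ insert-punchIn 0F i π k ⟩
    punchIn i (π ⟨$⟩ʳ k)      ≡⟨ cong (punchIn i) (eq k) ⟩
    punchIn i (ρ ⟨$⟩ʳ k)      ≡⟨ insert-punchIn 0F i ρ k ⟨
    insert 0F i ρ ⟨$⟩ʳ suc k  ∎
    where open ≡-Reasoning

  insert-injective : ∀ {n} {i j : Fin (suc n)} {π ρ : Permutation′ n} →
                     insert 0F i π ≈ insert 0F j ρ → i ≡ j × π ≈ ρ
  insert-injective {i = i} {π = π} {ρ = ρ} eq with refl ← eq 0F =
    refl , λ k → punchIn-injective i _ _ (begin
      punchIn i (π ⟨$⟩ʳ k)      ≡⟨ insert-punchIn 0F i π k ⟨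
      insert 0F i π ⟨$⟩ʳ suc k  ≡⟨ eq (suc k) ⟩
      insert 0F i ρ ⟨$⟩ʳ suc k  ≡⟨ insert-punchIn 0F i ρ k ⟩
      punchIn i (ρ ⟨$⟩ʳ k)      ∎)
    where open ≡-Reasoning

permutations-complete : ∀ {n} (π : Permutation′ n) → Any (π ≈_) (permutations n)
permutations-complete {zero}  π = here λ ()
permutations-complete {suc n} π =
  SetoidMembershipₚ.∈-resp-≈ (≈-setoid (suc n))
    {x = insert 0F (π ⟨$⟩ʳ 0F) (remove 0F π)} {y = π} (insert-remove 0F π)
    (SetoidMembershipₚ.∈-cartesianProductWith⁺
      (setoid (Fin (suc n))) (≈-setoid n) (≈-setoid (suc n))
      (λ {i} {j} {π} {ρ} → insert-cong {i = i} {j} {π} {ρ})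
      (∈-allFin (π ⟨$⟩ʳ 0F)) (permutations-complete (remove 0F π)))

permutations-unique : ∀ n → AllPairs (λ π ρ → ¬ π ≈ ρ) (permutations n)
permutations-unique zero    = [] ∷ []
permutations-unique (suc n) =
  SetoidUniqueₚ.cartesianProductWith⁺
    (setoid (Fin (suc n))) (≈-setoid n) (≈-setoid (suc n))
    (insert 0F) (λ {i} {j} {π} {ρ} → insert-injective {i = i} {j} {π} {ρ})
    (allFin⁺ (suc n)) (permutations-unique n)

module _ {n : ℕ} (π : Permutation′ n) where

  IsInversion : Pred (Fin n × Fin n) 0ℓ
  IsInversion (i , j) = i < j × π ⟨$⟩ʳ j < π ⟨$⟩ʳ i

  isInversion? : Decidable IsInversion
  isInversion? (i , j) = i <? j ×-dec (π ⟨$⟩ʳ j) <? (π ⟨$⟩ʳ i)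

  inversions : ℕ
  inversions = length (filter isInversion? (cartesianProduct (allFin n) (allFin n)))

-- `is` lists the positions in π of the entries of the subsequence.
IsOccurrence : ∀ {m n} → Permutation′ m → Permutation′ n → Vec (Fin n) m → Set
IsOccurrence q π is =
    (∀ a b → a < b → lookup is a < lookup is b)
  × (∀ a b → q ⟨$⟩ʳ a < q ⟨$⟩ʳ b ⇔ π ⟨$⟩ʳ lookup is a < π ⟨$⟩ʳ lookup is b)

Avoids : ∀ {m n} → Permutation′ n → Permutation′ m → Set
Avoids π q = ¬ ∃ (IsOccurrence q π)

Pattern : Set
Pattern = ∃ Permutation′

AvoidsAll : ∀ {n} → List Pattern → Permutation′ n → Set
AvoidsAll B π = All (λ (_ , q) → Avoids π q) B

isOccurrence? : ∀ {m n} (q : Permutation′ m) (π : Permutation′ n) →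
                Decidable (IsOccurrence q π)
isOccurrence? q π is =
  all? (λ a → all? λ b → a <? b →-dec lookup is a <? lookup is b)
  ×-dec
  all? (λ a → all? λ b →
    ((q ⟨$⟩ʳ a) <? (q ⟨$⟩ʳ b)) ⇔-dec
    ((π ⟨$⟩ʳ lookup is a) <? (π ⟨$⟩ʳ lookup is b)))
  where
  _⇔-dec_ : ∀ {A B : Set} → Dec A → Dec B → Dec (A ⇔ B)
  a? ⇔-dec b? = map′ (uncurry mk⇔) < Equivalence.to , Equivalence.from >
                     ((a? →-dec b?) ×-dec (b? →-dec a?))

anyVec? : ∀ {m n} {P : Pred (Vec (Fin n) m) 0ℓ} → Decidable P → Dec (∃ P)
anyVec? {zero}  P? = map′ ([] ,_) (λ { ([] , p) → p }) (P? [])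
anyVec? {suc m} P? =
  map′ (λ (i , is , p) → i ∷ is , p) (λ { (i ∷ is , p) → i , is , p })
       (any? λ i → anyVec? λ is → P? (i ∷ is))

avoids? : ∀ {m n} (π : Permutation′ n) (q : Permutation′ m) → Dec (Avoids π q)
avoids? π q = ¬? (anyVec? (isOccurrence? q π))

avoidsAll? : ∀ {n} B → Decidable (AvoidsAll {n} B)
avoidsAll? B π = All.all? (λ (_ , q) → avoids? π q) B

av : (n k : ℕ) → List Pattern → ℕ
av n k B = length
  (filter (λ π → inversions π ℕ.≟ k ×-dec avoidsAll? B π) (permutations n))

q1324 q2143 : Pattern
q1324 = 4 , transpose 1F 2F
q2143 = 4 , transpose 0F 1F ∘ₚ transpose 2F 3F

oneLine : ∀ {n} → Permutation′ n → Vec ℕ n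
oneLine π = Vec.tabulate λ i → suc (toℕ (π ⟨$⟩ʳ i))

_ : oneLine (proj₂ q1324) ≡ 1 ∷ 3 ∷ 2 ∷ 4 ∷ []
_ = refl

_ : oneLine (proj₂ q2143) ≡ 2 ∷ 1 ∷ 4 ∷ 3 ∷ []
_ = refl

IsPartition : ℕ → List ℕ → Set
IsPartition k ps = All (1 ≤_) ps × Linked _≥_ ps × sum ps ≡ k

isPartition? : ∀ k → Decidable (IsPartition k)
isPartition? k ps =
  All.all? (1 ℕ.≤?_) ps ×-dec Linked.linked? ℕ._≥?_ ps ×-dec (sum ps ℕ.≟ k)

-- All lists of length at most l with entries from xs.
listsUpTo : ℕ → List ℕ → List (List ℕ)
listsUpTo zero    xs = [] ∷ []
listsUpTo (suc l) xs = [] ∷ cartesianProductWith _∷_ xs (listsUpTo l xs)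

-- A partition of k has at most k parts, each of them at most k, so that
-- filtering these finitely many candidates loses nothing: see
-- partitions-complete and partitions-unique.
partitions : ℕ → List (List ℕ)
partitions k = filter (isPartition? k) (listsUpTo k (upTo (suc k)))

p : ℕ → ℕ
p k = length (partitions k)

private
  listsUpTo-complete : ∀ {l xs ys} → length ys ≤ l → All (_∈ xs) ys →
                       ys ∈ listsUpTo l xs
  listsUpTo-complete {zero}  z≤n       []           = here refl
  listsUpTo-complete {suc l} _         []           = here refl
  listsUpTo-complete {suc l} (s≤s len) (y∈xs ∷ ys∈) =
    there (∈-cartesianProductWith⁺ _∷_ y∈xs (listsUpTo-complete len ys∈))

  listsUpTo-unique : ∀ l {xs} → Unique xs → Unique (listsUpTo l xs)
  listsUpTo-unique zero         uniq = [] ∷ []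
  listsUpTo-unique (suc l) {xs} uniq =
    All.tabulate (λ {zs} zs∈ eq → []∉ (subst (_∈ _) (sym eq) zs∈)) ∷
    cartesianProductWith⁺ _∷_ ∷-injective uniq (listsUpTo-unique l uniq)
    where
    []∉ : ¬ ([] ∈ cartesianProductWith _∷_ xs (listsUpTo l xs))
    []∉ []∈ with () ← proj₂ (proj₂ (proj₂ (proj₂
      (∈-cartesianProductWith⁻ _∷_ xs (listsUpTo l xs) []∈))))

  length≤sum : ∀ {ps} → All (1 ≤_) ps → length ps ≤ sum ps
  length≤sum []          = z≤n
  length≤sum (1≤x ∷ all) = ℕ.+-mono-≤ 1≤x (length≤sum all)

  parts≤sum : ∀ ps → All (_≤ sum ps) ps
  parts≤sum []       = []
  parts≤sum (x ∷ ps) =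
    ℕ.m≤m+n x (sum ps) ∷ All.map (λ y≤ → ℕ.≤-trans y≤ (ℕ.m≤n+m _ x)) (parts≤sum ps)

partitions-complete : ∀ {k ps} → IsPartition k ps → ps ∈ partitions k
partitions-complete {ps = ps} isP@(pos , _ , refl) =
  ∈-filter⁺ (isPartition? _)
    (listsUpTo-complete (length≤sum pos)
      (All.map (λ x≤ → ∈-upTo⁺ (s≤s x≤)) (parts≤sum ps)))
    isP

partitions-unique : ∀ k → Unique (partitions k)
partitions-unique k = filter⁺ (isPartition? k) (listsUpTo-unique k (upTo⁺ (suc k)))

{-# OPTIONS --safe #-}
module Submission where

-- If π avoids 2143 and fixes neither the first nor the last position, then π
-- has at least n − 1 inversions; with only k ≤ n − 2 it fixes one of the ends.
-- If it fixes the last position, avoiding 1324 makes it avoid 132, which means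
-- that its Lehmer code is weakly decreasing, i.e. a partition of k padded with
-- zeros; every partition of k arises since k ≤ n − 2.  If it fixes the first
-- position, the same holds for its reverse-complement.  Both cannot happen
-- together: the code would have to start with 0, forcing k = 0.

open import Defs
open import Data.Fin as Fin using (Fin; zero; suc; toℕ; fromℕ; fromℕ<; inject; opposite; punchIn)
open import Data.Fin.Patterns using (0F; 1F; 2F; 3F)
open import Data.Fin.Permutation
  using (Permutation′; _⟨$⟩ʳ_; _⟨$⟩ˡ_; _≈_; _∘ₚ_; id; insert; remove; reverse; inverseˡ; inverseʳ;
         punchIn-permute; remove-insert)
import Data.Fin.Properties as Fin
open import Data.List
  using (List; []; _∷_; _++_; length; map; filter; allFin; upTo; cartesianProduct)
open import Data.List.Membership.Propositional using (_∈_; find; lose)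
open import Data.List.Membership.Propositional.Properties
  using (∈-allFin; ∈-filter⁺; ∈-filter⁻; ∈-cartesianProduct⁺; ∈-map⁺; ∈-map⁻; ∈-++⁺ˡ; ∈-++⁺ʳ; ∈-++⁻)
open import Data.List.Properties using (length-map; length-++; length-tabulate; length-removeAt′; filter-none)
open import Data.List.Relation.Unary.All as All using (All; []; _∷_)
open import Data.List.Relation.Unary.AllPairs as AllPairs using (AllPairs; []; _∷_)
import Data.List.Relation.Unary.All.Properties as All
import Data.List.Relation.Unary.AllPairs.Properties as AllPairs
open import Data.List.Relation.Unary.Any using (Any; here; there; index; _─_)
open import Data.List.Relation.Unary.Linked as Linked using (Linked; []; [-]; _∷_)
open import Data.List.Relation.Unary.Unique.Propositional using (Unique)
import Data.List.Relation.Unary.Unique.Propositional.Properties as Unique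
open import Data.Nat as ℕ using (ℕ; zero; suc; _+_; _*_; _≤_; _<_; _≥_; z≤n; s≤s)
open import Data.Nat.ListAction using (sum)
import Data.Nat.Properties as ℕ
open import Data.Product using (∃; _×_; _,_; proj₁; proj₂)
open import Data.Product.Properties using (,-injectiveˡ; ,-injectiveʳ)
open import Data.Sum using (_⊎_; inj₁; inj₂)
open import Data.Sum.Properties using (inj₁-injective; inj₂-injective)
open import Data.Vec using (Vec; []; _∷_; lookup)
open import Function.Base using (_∘_; flip)
open import Function.Bundles using (mk⇔; module Equivalence)
open import Relation.Binary.Definitions using (tri<; tri≈; tri>)
open import Relation.Binary.PropositionalEquality
  using (_≡_; _≢_; refl; sym; trans; cong; cong₂; subst; subst₂; module ≡-Reasoning)
open import Relation.Nullary using (¬_; Dec; yes; no; contradiction)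
open import Relation.Nullary.Decidable using (_×-dec_)
open import Relation.Unary using (Decidable)

-- Comparing the lengths of lists.

module _ {A B : Set} where

  -- The deleted element satisfies `P`, hence not `Q`, so the witness for `Q` sits elsewhere and
  -- survives.
  Any-─⁺ : ∀ {P Q : B → Set} {ys} (p : Any P ys) → (∀ y → P y → ¬ Q y) →
           Any Q ys → Any Q (ys ─ p)
  Any-─⁺ (here py) disj (here qy) = contradiction qy (disj _ py)
  Any-─⁺ (here py) disj (there q) = q
  Any-─⁺ (there p) disj (here qy) = here qy
  Any-─⁺ (there p) disj (there q) = there (Any-─⁺ p disj q)

  -- Delete a partner of the first element and recurse: the others keep theirs, since no partner is
  -- shared. A relation replaces an injective function because permutations are only compared
  -- pointwise.
  pigeonhole : (R : A → B → Set) {xs : List A} {ys : List B} →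
               AllPairs (λ x x′ → ∀ y → R x y → ¬ R x′ y) xs →
               All (λ x → Any (R x) ys) xs → length xs ≤ length ys
  pigeonhole R []              []        = z≤n
  pigeonhole R {x ∷ _} {ys} (disj ∷ disjs) (p ∷ ps) rewrite length-removeAt′ ys (index p) =
    s≤s (pigeonhole R disjs
      (All.zipWith (λ {x′} (d , q) → Any-─⁺ {P = R x} {Q = R x′} p d q) (disj , ps)))

module _ {A B : Set} where

  length-bijection : (f : B → A) → (∀ {y y′} → f y ≡ f y′ → y ≡ y′) → ∀ {xs ys} →
                     Unique xs → Unique ys →
                     (∀ {y} → y ∈ ys → f y ∈ xs) →
                     (∀ {x} → x ∈ xs → ∃ λ y → y ∈ ys × f y ≡ x) →
                     length xs ≡ length ys
  length-bijection f f-inj uxs uys to from = ℕ.≤-antisym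
    (pigeonhole (λ x y → f y ≡ x)
      (AllPairs.map (λ x≢x′ _ fy≡x fy≡x′ → x≢x′ (trans (sym fy≡x) fy≡x′)) uxs)
      (All.tabulate λ x∈ → let y , y∈ , eq = from x∈ in lose y∈ eq))
    (pigeonhole (λ y x → f y ≡ x)
      (AllPairs.map (λ y≢y′ _ fy≡x fy′≡x → y≢y′ (f-inj (trans fy≡x (sym fy′≡x)))) uys)
      (All.tabulate λ y∈ → lose (to y∈) refl))

  ⊎-unique : {xs : List A} {ys : List B} → Unique xs → Unique ys →
             Unique (map inj₁ xs ++ map inj₂ ys)
  ⊎-unique {xs} {ys} uxs uys = Unique.++⁺
    (Unique.map⁺ inj₁-injective uxs) (Unique.map⁺ inj₂-injective uys) disjoint
    where
    disjoint : ∀ {z} → ¬ (z ∈ map inj₁ xs × z ∈ map inj₂ ys)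
    disjoint (∈₁ , ∈₂)
      with _ , _ , refl ← ∈-map⁻ inj₁ ∈₁ | _ , _ , () ← ∈-map⁻ inj₂ ∈₂

-- Deleting the first entry: effect on values and inversions.

module _ {n} (p : Fin (suc n)) where

  punchIn-mono-< : ∀ {i j : Fin n} → i Fin.< j → punchIn p i Fin.< punchIn p j
  punchIn-mono-< i<j = ℕ.≰⇒> (ℕ.<⇒≱ i<j ∘ Fin.punchIn-cancel-≤ p _ _)

  punchIn-cancel-< : ∀ {i j : Fin n} → punchIn p i Fin.< punchIn p j → i Fin.< j
  punchIn-cancel-< lt = ℕ.≰⇒> (ℕ.<⇒≱ lt ∘ Fin.punchIn-mono-≤ p _ _)

punchIn-< : ∀ {n} (p : Fin (suc n)) (i : Fin n) → toℕ i < toℕ p → toℕ (punchIn p i) ≡ toℕ i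
punchIn-< (suc p) zero    i<p       = refl
punchIn-< (suc p) (suc i) (s≤s i<p) = cong suc (punchIn-< p i i<p)

punchIn-≥ : ∀ {n} (p : Fin (suc n)) (i : Fin n) → toℕ p ≤ toℕ i → toℕ (punchIn p i) ≡ suc (toℕ i)
punchIn-≥ zero    i       p≤i       = refl
punchIn-≥ (suc p) (suc i) (s≤s p≤i) = cong suc (punchIn-≥ p i p≤i)

module _ {n} (π : Permutation′ n) where

  ⟨$⟩ʳ-injective : ∀ {i j} → π ⟨$⟩ʳ i ≡ π ⟨$⟩ʳ j → i ≡ j
  ⟨$⟩ʳ-injective eq = trans (sym (inverseˡ π)) (trans (cong (π ⟨$⟩ˡ_) eq) (inverseˡ π))

  ⟨$⟩ˡ-injective : ∀ {i j} → π ⟨$⟩ˡ i ≡ π ⟨$⟩ˡ j → i ≡ j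
  ⟨$⟩ˡ-injective eq = trans (sym (inverseʳ π)) (trans (cong (π ⟨$⟩ʳ_) eq) (inverseʳ π))

  -- Its length is `inversions π` by definition.
  inversionList : List (Fin n × Fin n)
  inversionList = filter (isInversion? π) (cartesianProduct (allFin n) (allFin n))

  inversionList-unique : Unique inversionList
  inversionList-unique = Unique.filter⁺ (isInversion? π)
    (Unique.cartesianProduct⁺ (Unique.allFin⁺ n) (Unique.allFin⁺ n))

  ∈-inversionList⁺ : ∀ {i j} → IsInversion π (i , j) → (i , j) ∈ inversionList
  ∈-inversionList⁺ = ∈-filter⁺ (isInversion? π) (∈-cartesianProduct⁺ (∈-allFin _) (∈-allFin _))

  ∈-inversionList⁻ : ∀ {ij} → ij ∈ inversionList → IsInversion π ij
  ∈-inversionList⁻ ∈inv =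
    proj₂ (∈-filter⁻ (isInversion? π) {xs = cartesianProduct (allFin n) (allFin n)} ∈inv)

module _ {n} (π : Permutation′ (suc n)) where

  private
    π′ : Permutation′ n
    π′ = remove 0F π

  remove-mono : ∀ {i j} → π′ ⟨$⟩ʳ i Fin.< π′ ⟨$⟩ʳ j → π ⟨$⟩ʳ suc i Fin.< π ⟨$⟩ʳ suc j
  remove-mono {i} {j} lt = subst₂ Fin._<_
    (sym (punchIn-permute π 0F i)) (sym (punchIn-permute π 0F j))
    (punchIn-mono-< (π ⟨$⟩ʳ 0F) lt)

  remove-cancel : ∀ {i j} → π ⟨$⟩ʳ suc i Fin.< π ⟨$⟩ʳ suc j → π′ ⟨$⟩ʳ i Fin.< π′ ⟨$⟩ʳ j
  remove-cancel {i} {j} lt = punchIn-cancel-< (π ⟨$⟩ʳ 0F)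
    (subst₂ Fin._<_ (punchIn-permute π 0F i) (punchIn-permute π 0F j) lt)

  remove-< : ∀ {i} → π′ ⟨$⟩ʳ i Fin.< π ⟨$⟩ʳ 0F → toℕ (π ⟨$⟩ʳ suc i) ≡ toℕ (π′ ⟨$⟩ʳ i)
  remove-< {i} lt = trans (cong toℕ (punchIn-permute π 0F i)) (punchIn-< (π ⟨$⟩ʳ 0F) _ lt)

  remove-≥ : ∀ {i} → toℕ (π ⟨$⟩ʳ 0F) ≤ toℕ (π′ ⟨$⟩ʳ i) →
             toℕ (π ⟨$⟩ʳ suc i) ≡ suc (toℕ (π′ ⟨$⟩ʳ i))
  remove-≥ {i} le = trans (cong toℕ (punchIn-permute π 0F i)) (punchIn-≥ (π ⟨$⟩ʳ 0F) _ le)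

  -- The inversions at position 0 correspond to the values below the first entry; all others are
  -- inversions of the standardised rest.
  inversions-remove : inversions π ≡ toℕ (π ⟨$⟩ʳ 0F) + inversions π′
  inversions-remove = begin
    inversions π         ≡⟨ length-bijection f f-injective (inversionList-unique π) codes-unique to from ⟩
    length codes         ≡⟨ length-++ (map inj₁ smaller) ⟩
    length (map inj₁ smaller) + length (map inj₂ (inversionList π′))
                         ≡⟨ cong₂ _+_ (length-map inj₁ smaller) (length-map inj₂ (inversionList π′)) ⟩
    length smaller + inversions π′
                         ≡⟨ cong (_+ inversions π′) (length-tabulate {n = toℕ (π ⟨$⟩ʳ 0F)} _) ⟩
    toℕ (π ⟨$⟩ʳ 0F) + inversions π′  ∎
    where
    open ≡-Reasoning

    smaller : List (Fin (toℕ (π ⟨$⟩ʳ 0F)))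
    smaller = allFin _

    codes : List (Fin (toℕ (π ⟨$⟩ʳ 0F)) ⊎ Fin n × Fin n)
    codes = map inj₁ smaller ++ map inj₂ (inversionList π′)

    codes-unique : Unique codes
    codes-unique = ⊎-unique (Unique.allFin⁺ _) (inversionList-unique π′)

    -- An inversion at position 0 is recorded by its lower value, whose position the inverse
    -- permutation recovers.
    f : Fin (toℕ (π ⟨$⟩ʳ 0F)) ⊎ Fin n × Fin n → Fin (suc n) × Fin (suc n)
    f (inj₁ v)       = 0F , π ⟨$⟩ˡ inject v
    f (inj₂ (i , j)) = suc i , suc j

    f-injective : ∀ {x y} → f x ≡ f y → x ≡ y
    f-injective {inj₁ v} {inj₁ w} eq = cong inj₁ (Fin.toℕ-injective (begin
      toℕ v           ≡⟨ Fin.toℕ-inject v ⟨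
      toℕ (inject v)  ≡⟨ cong toℕ (⟨$⟩ˡ-injective π (,-injectiveʳ eq)) ⟩
      toℕ (inject w)  ≡⟨ Fin.toℕ-inject w ⟩
      toℕ w           ∎))
    f-injective {inj₂ _} {inj₂ _} refl = refl

    below : ∀ (v : Fin (toℕ (π ⟨$⟩ʳ 0F))) → inject v Fin.< π ⟨$⟩ʳ 0F
    below v = subst (_< _) (sym (Fin.toℕ-inject v)) (Fin.toℕ<n v)

    to : ∀ {y} → y ∈ codes → f y ∈ inversionList π
    to {inj₁ v} _ = ∈-inversionList⁺ π
      ( Fin.≤∧≢⇒< z≤n (λ 0≡ → ℕ.<⇒≢ (below v)
          (cong toℕ (trans (sym (inverseʳ π)) (cong (π ⟨$⟩ʳ_) (sym 0≡)))))
      , subst (Fin._< _) (sym (inverseʳ π)) (below v))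
    to {inj₂ (i , j)} y∈ =
      let i<j , lt = ∈-inversionList⁻ π′ (right (∈-++⁻ (map inj₁ smaller) y∈))
      in ∈-inversionList⁺ π (s≤s i<j , remove-mono lt)
      where
      right : inj₂ (i , j) ∈ map inj₁ smaller ⊎ inj₂ (i , j) ∈ map inj₂ (inversionList π′) →
              (i , j) ∈ inversionList π′
      right (inj₁ ∈ˡ) with () ← proj₂ (proj₂ (∈-map⁻ inj₁ ∈ˡ))
      right (inj₂ ∈ʳ) = let _ , ij∈ , eq = ∈-map⁻ inj₂ ∈ʳ in
        subst (_∈ inversionList π′) (sym (inj₂-injective eq)) ij∈

    from : ∀ {x} → x ∈ inversionList π → ∃ λ y → y ∈ codes × f y ≡ x
    from x∈ = decode (∈-inversionList⁻ π x∈)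
      where
      decode : ∀ {x} → IsInversion π x → ∃ λ y → y ∈ codes × f y ≡ x
      decode {zero , j} (_ , lt) =
        inj₁ (fromℕ< lt) , ∈-++⁺ˡ (∈-map⁺ inj₁ (∈-allFin _)) , cong (0F ,_) (begin
          π ⟨$⟩ˡ inject (fromℕ< lt)  ≡⟨ cong (π ⟨$⟩ˡ_) (Fin.toℕ-injective
                                          (trans (Fin.toℕ-inject (fromℕ< lt)) (Fin.toℕ-fromℕ< lt))) ⟩
          π ⟨$⟩ˡ (π ⟨$⟩ʳ j)          ≡⟨ inverseˡ π ⟩
          j                          ∎)
      decode {suc i , suc j} (s≤s i<j , lt) =
        inj₂ (i , j) ,
        ∈-++⁺ʳ (map inj₁ smaller) (∈-map⁺ inj₂ (∈-inversionList⁺ π′ (i<j , remove-cancel lt))) ,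
        refl

-- Pattern avoidance as inequalities between entries.

-- Only neighbours are compared: first the positions from left to right, then the values in
-- increasing order.
Avoids132 Avoids1324 Avoids2143 : ∀ {n} → Permutation′ n → Set
Avoids132 π = ∀ {x y z} → x Fin.< y → y Fin.< z →
  π ⟨$⟩ʳ x Fin.< π ⟨$⟩ʳ z → ¬ π ⟨$⟩ʳ z Fin.< π ⟨$⟩ʳ y
Avoids1324 π = ∀ {w x y z} → w Fin.< x → x Fin.< y → y Fin.< z →
  π ⟨$⟩ʳ w Fin.< π ⟨$⟩ʳ y → π ⟨$⟩ʳ y Fin.< π ⟨$⟩ʳ x → ¬ π ⟨$⟩ʳ x Fin.< π ⟨$⟩ʳ z
Avoids2143 π = ∀ {w x y z} → w Fin.< x → x Fin.< y → y Fin.< z →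
  π ⟨$⟩ʳ x Fin.< π ⟨$⟩ʳ w → π ⟨$⟩ʳ w Fin.< π ⟨$⟩ʳ z → ¬ π ⟨$⟩ʳ z Fin.< π ⟨$⟩ʳ y

increasing₄ : ∀ {n} (f : Fin 4 → Fin n) →
              f 0F Fin.< f 1F → f 1F Fin.< f 2F → f 2F Fin.< f 3F →
              ∀ a b → a Fin.< b → f a Fin.< f b
increasing₄ f p q r 0F 1F _ = p
increasing₄ f p q r 0F 2F _ = ℕ.<-trans p q
increasing₄ f p q r 0F 3F _ = ℕ.<-trans p (ℕ.<-trans q r)
increasing₄ f p q r 1F 2F _ = q
increasing₄ f p q r 1F 3F _ = ℕ.<-trans q r
increasing₄ f p q r 2F 3F _ = r
increasing₄ f p q r 1F 1F (s≤s ())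
increasing₄ f p q r 2F 1F (s≤s ())
increasing₄ f p q r 2F 2F (s≤s (s≤s ()))
increasing₄ f p q r 3F 1F (s≤s ())
increasing₄ f p q r 3F 2F (s≤s (s≤s ()))
increasing₄ f p q r 3F 3F (s≤s (s≤s (s≤s ())))

module _ {n} (q : Permutation′ 4) (π : Permutation′ n) (is : Vec (Fin n) 4) where

  private
    -- The entry in the role of the value `c` of `q`; order-isomorphism to `q` means that `entry` is
    -- increasing.
    entry : Fin 4 → Fin n
    entry c = π ⟨$⟩ʳ lookup is (q ⟨$⟩ˡ c)

  -- Comparisons of neighbours suffice: transitivity carries the order of `q` over to `π`, and
  -- trichotomy gives the converse.
  isOccurrence⁺ :
    lookup is 0F Fin.< lookup is 1F → lookup is 1F Fin.< lookup is 2F →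
    lookup is 2F Fin.< lookup is 3F →
    entry 0F Fin.< entry 1F → entry 1F Fin.< entry 2F → entry 2F Fin.< entry 3F →
    IsOccurrence q π is
  isOccurrence⁺ i₁ i₂ i₃ e₁ e₂ e₃ =
    increasing₄ (lookup is) i₁ i₂ i₃ , λ a b → mk⇔ (to a b) (from a b)
    where
    to : ∀ a b → q ⟨$⟩ʳ a Fin.< q ⟨$⟩ʳ b → π ⟨$⟩ʳ lookup is a Fin.< π ⟨$⟩ʳ lookup is b
    to a b lt = subst₂ (λ c d → π ⟨$⟩ʳ lookup is c Fin.< π ⟨$⟩ʳ lookup is d)
      (inverseˡ q) (inverseˡ q) (increasing₄ entry e₁ e₂ e₃ (q ⟨$⟩ʳ a) (q ⟨$⟩ʳ b) lt)

    from : ∀ a b → π ⟨$⟩ʳ lookup is a Fin.< π ⟨$⟩ʳ lookup is b → q ⟨$⟩ʳ a Fin.< q ⟨$⟩ʳ b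
    from a b lt with Fin.<-cmp (q ⟨$⟩ʳ a) (q ⟨$⟩ʳ b)
    ... | tri< qa<qb _ _ = qa<qb
    ... | tri≈ _ qa≡qb _ with refl ← ⟨$⟩ʳ-injective q qa≡qb = contradiction lt (ℕ.<-irrefl refl)
    ... | tri> _ _ qb<qa = contradiction lt (ℕ.<-asym (to b a qb<qa))

module _ {n} (π : Permutation′ n) where

  -- The inverse of the concrete pattern evaluates, so the inequalities agree definitionally with
  -- those of `isOccurrence⁺`.
  avoids-q1324 : Avoids π (proj₂ q1324) → Avoids1324 π
  avoids-q1324 av {w} {x} {y} {z} i₁ i₂ i₃ e₁ e₂ e₃ =
    let is = w ∷ x ∷ y ∷ z ∷ [] in
    av (is , isOccurrence⁺ (proj₂ q1324) π is i₁ i₂ i₃ e₁ e₂ e₃)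

  avoids-q2143 : Avoids π (proj₂ q2143) → Avoids2143 π
  avoids-q2143 av {w} {x} {y} {z} i₁ i₂ i₃ e₁ e₂ e₃ =
    let is = w ∷ x ∷ y ∷ z ∷ [] in
    av (is , isOccurrence⁺ (proj₂ q2143) π is i₁ i₂ i₃ e₁ e₂ e₃)

-- Reverse-complement and its effect on inversions and patterns.

opposite-mono : ∀ {n} {i j : Fin n} → i Fin.< j → opposite j Fin.< opposite i
opposite-mono {i = i} {j} i<j = subst₂ _<_ (sym (Fin.opposite-prop j)) (sym (Fin.opposite-prop i))
  (ℕ.∸-monoʳ-< (s≤s i<j) (Fin.toℕ<n j))

opposite-cancel : ∀ {n} {i j : Fin n} → opposite i Fin.< opposite j → j Fin.< i
opposite-cancel lt =
  subst₂ Fin._<_ (Fin.opposite-involutive _) (Fin.opposite-involutive _) (opposite-mono lt)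

opposite-injective : ∀ {n} {i j : Fin n} → opposite i ≡ opposite j → i ≡ j
opposite-injective = ⟨$⟩ʳ-injective reverse

reverseComplement : ∀ {n} → Permutation′ n → Permutation′ n
reverseComplement π = reverse ∘ₚ π ∘ₚ reverse

module _ {n} {π ρ : Permutation′ n} where

  reverseComplement-cong : π ≈ ρ → reverseComplement π ≈ reverseComplement ρ
  reverseComplement-cong eq i = cong opposite (eq (opposite i))

  reverseComplement-injective : reverseComplement π ≈ reverseComplement ρ → π ≈ ρ
  reverseComplement-injective eq i =
    subst (λ i → π ⟨$⟩ʳ i ≡ ρ ⟨$⟩ʳ i) (Fin.opposite-involutive i)
      (opposite-injective (eq (opposite i)))

module _ {n} (π : Permutation′ n) where

  reverseComplement-involutive : reverseComplement (reverseComplement π) ≈ π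
  reverseComplement-involutive i =
    trans (Fin.opposite-involutive _) (cong (π ⟨$⟩ʳ_) (Fin.opposite-involutive i))

  reverseComplement-mono : ∀ {i j} → π ⟨$⟩ʳ i Fin.< π ⟨$⟩ʳ j →
    reverseComplement π ⟨$⟩ʳ opposite j Fin.< reverseComplement π ⟨$⟩ʳ opposite i
  reverseComplement-mono lt = opposite-mono (subst₂ (λ i j → π ⟨$⟩ʳ i Fin.< π ⟨$⟩ʳ j)
    (sym (Fin.opposite-involutive _)) (sym (Fin.opposite-involutive _)) lt)

  -- Reversal exchanges the two positions of a pair and complementation reverses the order of its
  -- values, so inversions correspond to inversions.
  inversions-reverseComplement : inversions (reverseComplement π) ≡ inversions π
  inversions-reverseComplement = sym (length-bijection f f-injective
    (inversionList-unique π) (inversionList-unique (reverseComplement π)) to from)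
    where
    f : Fin n × Fin n → Fin n × Fin n
    f (i , j) = opposite j , opposite i

    f-injective : ∀ {x y} → f x ≡ f y → x ≡ y
    f-injective eq =
      cong₂ _,_ (opposite-injective (,-injectiveʳ eq)) (opposite-injective (,-injectiveˡ eq))

    to : ∀ {y} → y ∈ inversionList (reverseComplement π) → f y ∈ inversionList π
    to y∈ = let i<j , lt = ∈-inversionList⁻ (reverseComplement π) y∈ in
      ∈-inversionList⁺ π (opposite-mono i<j , opposite-cancel lt)

    from : ∀ {x} → x ∈ inversionList π → ∃ λ y → y ∈ inversionList (reverseComplement π) × f y ≡ x
    from {i , j} x∈ = let i<j , lt = ∈-inversionList⁻ π x∈ in
      f (i , j) ,
      ∈-inversionList⁺ (reverseComplement π) (opposite-mono i<j , reverseComplement-mono lt) ,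
      cong₂ _,_ (Fin.opposite-involutive i) (Fin.opposite-involutive j)

  -- The pattern 1324 is its own reverse-complement.
  avoids1324-reverseComplement : Avoids1324 π → Avoids1324 (reverseComplement π)
  avoids1324-reverseComplement av i₁ i₂ i₃ e₁ e₂ e₃ =
    av (opposite-mono i₃) (opposite-mono i₂) (opposite-mono i₁)
       (opposite-cancel e₃) (opposite-cancel e₂) (opposite-cancel e₁)

-- Both patterns contain 132: as 132 in 1324 and as 143 in 2143.
avoids132⇒avoidsAll : ∀ {n} (π : Permutation′ n) → Avoids132 π →
                      AvoidsAll (q1324 ∷ q2143 ∷ []) π
avoids132⇒avoidsAll π av =
  (λ (is , inc , ord) → av (inc 0F 1F (s≤s z≤n)) (inc 1F 2F (s≤s (s≤s z≤n)))
    (Equivalence.to (ord 0F 2F) (s≤s z≤n)) (Equivalence.to (ord 2F 1F) (s≤s (s≤s z≤n)))) ∷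
  (λ (is , inc , ord) → av (inc 1F 2F (s≤s (s≤s z≤n))) (inc 2F 3F (s≤s (s≤s (s≤s z≤n))))
    (Equivalence.to (ord 1F 3F) (s≤s z≤n)) (Equivalence.to (ord 3F 2F) (s≤s (s≤s (s≤s z≤n))))) ∷ []

-- The reverse-complement of 132 is 213, which occurs as 324 in 1324 and as 214 in 2143.
avoids132-reverseComplement⇒avoidsAll :
  ∀ {n} (π : Permutation′ n) → Avoids132 (reverseComplement π) →
  AvoidsAll (q1324 ∷ q2143 ∷ []) π
avoids132-reverseComplement⇒avoidsAll π av =
  (λ (is , inc , ord) → av
    (opposite-mono (inc 2F 3F (s≤s (s≤s (s≤s z≤n))))) (opposite-mono (inc 1F 2F (s≤s (s≤s z≤n))))
    (reverseComplement-mono π (Equivalence.to (ord 1F 3F) (s≤s (s≤s (s≤s z≤n)))))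
    (reverseComplement-mono π (Equivalence.to (ord 2F 1F) (s≤s (s≤s z≤n))))) ∷
  (λ (is , inc , ord) → av
    (opposite-mono (inc 1F 2F (s≤s (s≤s z≤n)))) (opposite-mono (inc 0F 1F (s≤s z≤n)))
    (reverseComplement-mono π (Equivalence.to (ord 0F 2F) (s≤s (s≤s z≤n))))
    (reverseComplement-mono π (Equivalence.to (ord 1F 0F) (s≤s z≤n)))) ∷ []

-- A 132 cannot use the final maximum, so appending that maximum to it would give a 1324.
avoids132-of-last : ∀ {n} (π : Permutation′ (suc n)) → Avoids1324 π →
                    π ⟨$⟩ʳ fromℕ n ≡ fromℕ n → Avoids132 π
avoids132-of-last {n} π av πlast {x} {y} {z} x<y y<z πx<πz πz<πy =
  av x<y y<z (Fin.≤∧≢⇒< (Fin.≤fromℕ z) z≢last) πx<πz πz<πy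
    (subst (π ⟨$⟩ʳ y Fin.<_) (sym πlast) (Fin.≤∧≢⇒< (Fin.≤fromℕ _) πy≢last))
  where
  z≢last : z ≢ fromℕ n
  z≢last refl = ℕ.<⇒≱ πz<πy (subst (π ⟨$⟩ʳ y Fin.≤_) (sym πlast) (Fin.≤fromℕ _))

  πy≢last : π ⟨$⟩ʳ y ≢ fromℕ n
  πy≢last eq with refl ← ⟨$⟩ʳ-injective π (trans eq (sym πlast)) = ℕ.<⇒≱ y<z (Fin.≤fromℕ z)

-- A lower bound on the number of inversions.

-- The last entry forms an inversion with every larger entry, and there are `m` minus its value of
-- these.
inversions-last : ∀ m (π : Permutation′ (suc m)) → m ≤ inversions π + toℕ (π ⟨$⟩ʳ fromℕ m)
inversions-last zero    π = z≤n
inversions-last (suc m) π = begin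
  suc m                         ≤⟨ s≤s (inversions-last m π′) ⟩
  suc (inversions π′ + last′)   ≡⟨ ℕ.+-suc (inversions π′) last′ ⟨
  inversions π′ + suc last′     ≤⟨ ℕ.+-monoʳ-≤ (inversions π′) (last′< (ℕ.<-≤-connex last′ first)) ⟩
  inversions π′ + (first + last) ≡⟨ ℕ.+-assoc (inversions π′) first last ⟨
  inversions π′ + first + last  ≡⟨ cong (_+ last) (ℕ.+-comm (inversions π′) first) ⟩
  first + inversions π′ + last  ≡⟨ cong (_+ last) (inversions-remove π) ⟨
  inversions π + last           ∎
  where
  open ℕ.≤-Reasoning
  π′ = remove 0F π
  first = toℕ (π ⟨$⟩ʳ 0F)
  last  = toℕ (π ⟨$⟩ʳ fromℕ (suc m))
  last′ = toℕ (π′ ⟨$⟩ʳ fromℕ m)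

  -- Either `first` alone exceeds `last′`, or deleting the first entry has lowered the last one by
  -- one.
  last′< : last′ < first ⊎ first ≤ last′ → last′ < first + last
  last′< (inj₁ lt) = ℕ.≤-trans lt (ℕ.m≤m+n first last)
  last′< (inj₂ ge) = subst (_≤ first + last) (remove-≥ π ge) (ℕ.m≤n+m last first)

-- Induction by deleting the first entry, which is nonzero and so contributes an inversion. If it is
-- the maximum, it contributes enough by itself. Otherwise the rest does not fix its last position,
-- and the induction hypothesis applies unless the rest fixes its first one. In that case either the
-- last entry is small and `inversions-last` gives the bound, or a 2143 appears.
avoids2143⇒inversions-≥ :
  ∀ m (π : Permutation′ (suc m)) → Avoids2143 π →
  π ⟨$⟩ʳ 0F ≢ 0F → π ⟨$⟩ʳ fromℕ m ≢ fromℕ m → m ≤ inversions π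
avoids2143⇒inversions-≥ zero    π av π0≢0 πlast≢last = z≤n
avoids2143⇒inversions-≥ (suc m) π av π0≢0 πlast≢last =
  subst (suc m ≤_) (sym (inversions-remove π)) (bound (π ⟨$⟩ʳ 0F Fin.≟ fromℕ (suc m)))
  where
  π′ : Permutation′ (suc m)
  π′ = remove 0F π

  π0>0 : 0 < toℕ (π ⟨$⟩ʳ 0F)
  π0>0 = Fin.≤∧≢⇒< {i = 0F} z≤n (π0≢0 ∘ sym)

  π0≤m : π ⟨$⟩ʳ 0F ≢ fromℕ (suc m) → toℕ (π ⟨$⟩ʳ 0F) ≤ m
  π0≤m π0≢last = ℕ.s≤s⁻¹ (subst (toℕ (π ⟨$⟩ʳ 0F) <_) (Fin.toℕ-fromℕ (suc m))
    (Fin.≤∧≢⇒< (Fin.≤fromℕ _) π0≢last))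

  -- The first entry is at most `m`, so a last entry `m` of the rest would stand for `suc m`, the
  -- maximum, at the end of `π`.
  π′last≢last : π ⟨$⟩ʳ 0F ≢ fromℕ (suc m) → π′ ⟨$⟩ʳ fromℕ m ≢ fromℕ m
  π′last≢last π0≢last eq = πlast≢last (Fin.toℕ-injective (trans
    (remove-≥ π (subst (toℕ (π ⟨$⟩ʳ 0F) ≤_) (sym toℕ-π′last) (π0≤m π0≢last)))
    (cong suc (cong toℕ eq))))
    where
    toℕ-π′last : toℕ (π′ ⟨$⟩ʳ fromℕ m) ≡ m
    toℕ-π′last = trans (cong toℕ eq) (Fin.toℕ-fromℕ m)

  top : Fin (suc m)
  top = π′ ⟨$⟩ˡ fromℕ m

  π′top : π′ ⟨$⟩ʳ top ≡ fromℕ m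
  π′top = inverseʳ π′

  inner : π′ ⟨$⟩ʳ fromℕ m ≢ fromℕ m → Dec (π′ ⟨$⟩ʳ 0F ≡ 0F) →
          toℕ (π′ ⟨$⟩ʳ fromℕ m) < toℕ (π ⟨$⟩ʳ 0F) ⊎ toℕ (π ⟨$⟩ʳ 0F) ≤ toℕ (π′ ⟨$⟩ʳ fromℕ m) →
          suc m ≤ toℕ (π ⟨$⟩ʳ 0F) + inversions π′
  inner π′last≢last (no π′0≢0) _ = ℕ.+-mono-≤ π0>0
    (avoids2143⇒inversions-≥ m π′
      (λ i₁ i₂ i₃ e₁ e₂ e₃ → av (s≤s i₁) (s≤s i₂) (s≤s i₃)
        (remove-mono π e₁) (remove-mono π e₂) (remove-mono π e₃))
      π′0≢0 π′last≢last)
  inner π′last≢last (yes π′0≡0) (inj₁ π′last<π0) = begin-strict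
    m                                      ≤⟨ inversions-last m π′ ⟩
    inversions π′ + toℕ (π′ ⟨$⟩ʳ fromℕ m)  <⟨ ℕ.+-monoʳ-< (inversions π′) π′last<π0 ⟩
    inversions π′ + toℕ (π ⟨$⟩ʳ 0F)        ≡⟨ ℕ.+-comm (inversions π′) (toℕ (π ⟨$⟩ʳ 0F)) ⟩
    toℕ (π ⟨$⟩ʳ 0F) + inversions π′        ∎
    where open ℕ.≤-Reasoning
  -- The entries of π at 0 and 1, its maximum and its last entry form a 2143.
  inner π′last≢last (yes π′0≡0) (inj₂ π0≤π′last) = contradiction πlast<πtop
    (av {w = 0F} {x = 1F} {y = suc top} {z = suc (fromℕ m)}
      (s≤s z≤n) (s≤s 0<top) (s≤s (Fin.≤∧≢⇒< (Fin.≤fromℕ top) top≢last)) π1<π0 π0<πlast)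
    where
    0<top : 0 < toℕ top
    -- If the maximum stood at position 0, where the entry is 0, then `π′` would have a single
    -- position and fix it.
    0<top = Fin.≤∧≢⇒< {i = 0F} z≤n λ 0≡top →
      let 0≡last = trans (sym π′0≡0) (trans (cong (π′ ⟨$⟩ʳ_) 0≡top) π′top) in
      π′last≢last (trans (cong (π′ ⟨$⟩ʳ_) (sym 0≡last)) (trans π′0≡0 0≡last))

    top≢last : top ≢ fromℕ m
    top≢last eq = π′last≢last (trans (cong (π′ ⟨$⟩ʳ_) (sym eq)) π′top)

    π1<π0 : π ⟨$⟩ʳ 1F Fin.< π ⟨$⟩ʳ 0F
    π1<π0 = subst (_< toℕ (π ⟨$⟩ʳ 0F))
      (sym (trans (remove-< π (subst (Fin._< π ⟨$⟩ʳ 0F) (sym π′0≡0) π0>0)) (cong toℕ π′0≡0))) π0>0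

    π0<πlast : π ⟨$⟩ʳ 0F Fin.< π ⟨$⟩ʳ suc (fromℕ m)
    π0<πlast = subst (toℕ (π ⟨$⟩ʳ 0F) <_) (sym (remove-≥ π π0≤π′last)) (s≤s π0≤π′last)

    πlast<πtop : π ⟨$⟩ʳ suc (fromℕ m) Fin.< π ⟨$⟩ʳ suc top
    πlast<πtop = remove-mono π (subst (π′ ⟨$⟩ʳ fromℕ m Fin.<_) (sym π′top)
      (Fin.≤∧≢⇒< (Fin.≤fromℕ _) π′last≢last))

  bound : Dec (π ⟨$⟩ʳ 0F ≡ fromℕ (suc m)) → suc m ≤ toℕ (π ⟨$⟩ʳ 0F) + inversions π′
  bound (yes π0≡last) = ℕ.≤-trans
    (ℕ.≤-reflexive (sym (trans (cong toℕ π0≡last) (Fin.toℕ-fromℕ (suc m))))) (ℕ.m≤m+n _ _)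
  bound (no π0≢last) = inner (π′last≢last π0≢last) (π′ ⟨$⟩ʳ 0F Fin.≟ 0F) (ℕ.<-≤-connex _ _)

-- Lehmer codes and partitions.

-- The Lehmer code of π, with trailing zeros optional.
data HasCode : ∀ {n} → Permutation′ n → List ℕ → Set where
  []  : ∀ {n} {π : Permutation′ n} → π ≈ id → HasCode π []
  _∷_ : ∀ {n} {π : Permutation′ (suc n)} {c cs} →
        toℕ (π ⟨$⟩ʳ 0F) ≡ c → HasCode (remove 0F π) cs → HasCode π (c ∷ cs)

remove-cong : ∀ {n} {π ρ : Permutation′ (suc n)} → π ≈ ρ → remove 0F π ≈ remove 0F ρ
remove-cong {π = π} {ρ} eq i = Fin.punchIn-injective (π ⟨$⟩ʳ 0F) _ _ (begin
  punchIn (π ⟨$⟩ʳ 0F) (remove 0F π ⟨$⟩ʳ i)  ≡⟨ punchIn-permute π 0F i ⟨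
  π ⟨$⟩ʳ suc i                              ≡⟨ eq (suc i) ⟩
  ρ ⟨$⟩ʳ suc i                              ≡⟨ punchIn-permute ρ 0F i ⟩
  punchIn (ρ ⟨$⟩ʳ 0F) (remove 0F ρ ⟨$⟩ʳ i)  ≡⟨ cong (λ j → punchIn j (remove 0F ρ ⟨$⟩ʳ i)) (eq 0F) ⟨
  punchIn (π ⟨$⟩ʳ 0F) (remove 0F ρ ⟨$⟩ʳ i)  ∎)
  where open ≡-Reasoning

HasCode-resp-≈ : ∀ {n cs} {π ρ : Permutation′ n} → π ≈ ρ → HasCode π cs → HasCode ρ cs
HasCode-resp-≈ eq ([] π≈id)   = [] λ i → trans (sym (eq i)) (π≈id i)
HasCode-resp-≈ {π = π} {ρ} eq (π0≡c ∷ h) =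
  trans (cong toℕ (sym (eq 0F))) π0≡c ∷ HasCode-resp-≈ (remove-cong {π = π} {ρ} eq) h

HasCode-injective : ∀ {n cs} {π ρ : Permutation′ n} → HasCode π cs → HasCode ρ cs → π ≈ ρ
HasCode-injective ([] π≈id)  ([] ρ≈id)   i       = trans (π≈id i) (sym (ρ≈id i))
HasCode-injective (π0≡c ∷ _) (ρ0≡c ∷ _)  zero    = Fin.toℕ-injective (trans π0≡c (sym ρ0≡c))
HasCode-injective {π = π} {ρ} (π0≡c ∷ h) (ρ0≡c ∷ h′) (suc i) = begin
  π ⟨$⟩ʳ suc i                              ≡⟨ punchIn-permute π 0F i ⟩
  punchIn (π ⟨$⟩ʳ 0F) (remove 0F π ⟨$⟩ʳ i)  ≡⟨ cong₂ punchIn (Fin.toℕ-injective (trans π0≡c (sym ρ0≡c)))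
                                                             (HasCode-injective h h′ i) ⟩
  punchIn (ρ ⟨$⟩ʳ 0F) (remove 0F ρ ⟨$⟩ʳ i)  ≡⟨ punchIn-permute ρ 0F i ⟨
  ρ ⟨$⟩ʳ suc i                              ∎
  where open ≡-Reasoning

-- Optional trailing zeros are the only ambiguity, and positivity excludes them: a nonempty code
-- then starts with a nonzero entry, which the identity does not have.
HasCode-functional : ∀ {n cs ds} {π : Permutation′ n} → All (1 ≤_) cs → All (1 ≤_) ds →
                     HasCode π cs → HasCode π ds → cs ≡ ds
HasCode-functional []           []           ([] _)       ([] _)     = refl
HasCode-functional []           (1≤d ∷ _)    ([] π≈id)    (refl ∷ _) =
  contradiction (cong toℕ (π≈id 0F)) (ℕ.>⇒≢ 1≤d)
HasCode-functional (1≤c ∷ _)    []           (refl ∷ _)   ([] π≈id)  =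
  contradiction (cong toℕ (π≈id 0F)) (ℕ.>⇒≢ 1≤c)
HasCode-functional (_ ∷ pos)    (_ ∷ pos′)   (refl ∷ h)   (refl ∷ h′) =
  cong (_ ∷_) (HasCode-functional pos pos′ h h′)

inversions-code : ∀ {n cs} {π : Permutation′ n} → HasCode π cs → inversions π ≡ sum cs
inversions-code {n} {π = π} ([] π≈id) = cong length (filter-none (isInversion? π)
  {xs = cartesianProduct (allFin n) (allFin n)} (All.tabulate λ {(i , j)} _ (i<j , πj<πi) →
    ℕ.<-asym i<j (subst₂ Fin._<_ (π≈id j) (π≈id i) πj<πi)))
inversions-code {π = π} (refl ∷ h) =
  trans (inversions-remove π) (cong (toℕ (π ⟨$⟩ʳ 0F) +_) (inversions-code h))

-- The maximum of a weakly decreasing list; the value 0 on the empty list agrees with omitted zeros.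
largest : List ℕ → ℕ
largest []      = 0
largest (c ∷ _) = c

largest-tail : ∀ {c cs} → Linked _≥_ (c ∷ cs) → largest cs ≤ c
largest-tail [-]       = z≤n
largest-tail (c≥d ∷ _) = c≥d

Linked-∷ : ∀ {c cs} → largest cs ≤ c → Linked _≥_ cs → Linked _≥_ (c ∷ cs)
Linked-∷ {cs = []}    _   _    = [-]
Linked-∷ {cs = _ ∷ _} c≥d link = c≥d ∷ link

-- For an inversion away from position 0, induction puts the lower entry of the standardised rest
-- below the next code entry, hence below the first entry of `π`; it is therefore not shifted by the
-- deletion.
inversion-bottom-<-largest :
  ∀ {n cs} {π : Permutation′ n} {i j} → HasCode π cs → Linked _≥_ cs →
  i Fin.< j → π ⟨$⟩ʳ j Fin.< π ⟨$⟩ʳ i → toℕ (π ⟨$⟩ʳ j) < largest cs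
inversion-bottom-<-largest ([] π≈id) link i<j πj<πi =
  contradiction (subst₂ Fin._<_ (π≈id _) (π≈id _) πj<πi) (ℕ.<-asym i<j)
inversion-bottom-<-largest {i = zero}  (refl ∷ h) link i<j πj<πi = πj<πi
inversion-bottom-<-largest {π = π} {suc i} {suc j} (refl ∷ h) link (s≤s i<j) πj<πi =
  subst (_< toℕ (π ⟨$⟩ʳ 0F)) (sym (remove-< π π′j<π0)) π′j<π0
  where
  π′j<π0 : remove 0F π ⟨$⟩ʳ j Fin.< π ⟨$⟩ʳ 0F
  π′j<π0 = ℕ.<-≤-trans
    (inversion-bottom-<-largest h (Linked.tail link) i<j (remove-cancel π πj<πi))
    (largest-tail link)

-- A 132 beginning at position 0 would contain an inversion whose lower entry exceeds the first
-- entry, against `inversion-bottom-<-largest`; any other 132 lies in the rest.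
code⇒avoids132 : ∀ {n cs} {π : Permutation′ n} → HasCode π cs → Linked _≥_ cs → Avoids132 π
code⇒avoids132 ([] π≈id) link x<y y<z πx<πz πz<πy =
  ℕ.<-asym y<z (subst₂ Fin._<_ (π≈id _) (π≈id _) πz<πy)
code⇒avoids132 {π = π} (refl ∷ h) link {zero} x<y y<z πx<πz πz<πy =
  ℕ.<-asym πx<πz (inversion-bottom-<-largest {π = π} (refl ∷ h) link y<z πz<πy)
code⇒avoids132 {π = π} (refl ∷ h) link {suc x} {suc y} {suc z} (s≤s x<y) (s≤s y<z) πx<πz πz<πy =
  code⇒avoids132 h (Linked.tail link) x<y y<z (remove-cancel π πx<πz) (remove-cancel π πz<πy)

-- Deleting the first entry lowers the sum by at least one, so the bound persists and the rest ends
-- with its maximum. As `c` does not exceed that maximum, restoring the first entry raises it by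
-- one.
code⇒last : ∀ {m cs} {π : Permutation′ (suc m)} → HasCode π cs → All (1 ≤_) cs → sum cs < m →
            π ⟨$⟩ʳ fromℕ m ≡ fromℕ m
code⇒last ([] π≈id) _ _ = π≈id _
code⇒last {suc m} {c ∷ cs} {π} (refl ∷ h) (1≤c ∷ pos) sum<1+m = Fin.toℕ-injective (trans
  (remove-≥ π (subst (c ≤_) (sym toℕ-last) (ℕ.m+n≤o⇒m≤o c (ℕ.s≤s⁻¹ sum<1+m))))
  (cong (suc ∘ toℕ) last))
  where
  last : remove 0F π ⟨$⟩ʳ fromℕ m ≡ fromℕ m
  last = code⇒last h pos (ℕ.≤-trans (ℕ.+-monoˡ-≤ (sum cs) 1≤c) (ℕ.s≤s⁻¹ sum<1+m))

  toℕ-last : toℕ (remove 0F π ⟨$⟩ʳ fromℕ m) ≡ m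
  toℕ-last = trans (cong toℕ last) (Fin.toℕ-fromℕ m)

-- A code entry must be less than the number of positions left. Positive parts make the remaining
-- sum drop at least as fast as that number; `ℕ.pred` covers `n = 0`, where only the empty code
-- fits.
partition⇒code : ∀ n {cs} → All (1 ≤_) cs → sum cs ≤ ℕ.pred n →
                 ∃ λ (π : Permutation′ n) → HasCode π cs
partition⇒code n       []          _    = id , [] (λ _ → refl)
partition⇒code zero    {c ∷ _}  (1≤c ∷ pos) sum≤ =
  contradiction (ℕ.≤-trans 1≤c (ℕ.m+n≤o⇒m≤o c sum≤)) λ ()
partition⇒code (suc n) {c ∷ cs} (1≤c ∷ pos) sum≤ =
  let π , h = partition⇒code n pos
        (ℕ.≤-trans (ℕ.<⇒≤pred (ℕ.+-monoˡ-≤ (sum cs) 1≤c)) (ℕ.pred-mono-≤ sum≤))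
      c<1+n = s≤s (ℕ.m+n≤o⇒m≤o c sum≤)
      j     = fromℕ< c<1+n
  in insert 0F j π ,
     Fin.toℕ-fromℕ< c<1+n ∷
     HasCode-resp-≈ {π = π} {remove 0F (insert 0F j π)} (λ i → sym (remove-insert 0F j π i)) h

-- By `largest≤` the first entry bounds the code of the rest, so prepending it keeps the code weakly
-- decreasing.
avoids132⇒code : ∀ {n} (π : Permutation′ n) → Avoids132 π →
                 ∃ λ cs → All (1 ≤_) cs × Linked _≥_ cs × HasCode π cs
avoids132⇒code {zero}  π av = [] , [] , [] , [] λ ()
avoids132⇒code {suc n} π av = cons (avoids132⇒code π′
    (λ x<y y<z e₁ e₂ → av (s≤s x<y) (s≤s y<z) (remove-mono π e₁) (remove-mono π e₂)))
  where
  π′ : Permutation′ n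
  π′ = remove 0F π

  -- Otherwise π would contain 132: its first two entries and the value just
  -- above the first one.
  largest≤ : ∀ {cs} → HasCode π′ cs → largest cs ≤ toℕ (π ⟨$⟩ʳ 0F)
  largest≤ ([] _) = z≤n
  largest≤ (_∷_ {c = d} π′0≡d _) = ℕ.≮⇒≥ λ π0<d →
    let π0<π′0 : π ⟨$⟩ʳ 0F Fin.< π′ ⟨$⟩ʳ 0F
        π0<π′0 = subst (toℕ (π ⟨$⟩ʳ 0F) <_) (sym π′0≡d) π0<d
        v = fromℕ< (ℕ.<-trans π0<π′0 (Fin.toℕ<n _))
        toℕ-v : toℕ v ≡ toℕ (π ⟨$⟩ʳ 0F)
        toℕ-v = Fin.toℕ-fromℕ< _
        z = π′ ⟨$⟩ˡ v
        toℕ-π′z : toℕ (π′ ⟨$⟩ʳ z) ≡ toℕ (π ⟨$⟩ʳ 0F)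
        toℕ-π′z = trans (cong toℕ (inverseʳ π′)) toℕ-v
    in av {0F} {1F} {suc z} (s≤s z≤n)
      (s≤s (Fin.≤∧≢⇒< {i = 0F} z≤n λ 0≡z →
        ℕ.<⇒≢ π0<π′0 (trans (sym toℕ-π′z) (cong (λ i → toℕ (π′ ⟨$⟩ʳ i)) (sym 0≡z)))))
      (subst (toℕ (π ⟨$⟩ʳ 0F) <_) (sym (remove-≥ π (ℕ.≤-reflexive (sym toℕ-π′z))))
        (s≤s (ℕ.≤-reflexive (sym toℕ-π′z))))
      (remove-mono π (subst (_< toℕ (π′ ⟨$⟩ʳ 0F)) (sym toℕ-π′z) π0<π′0))

  cons : (∃ λ cs → All (1 ≤_) cs × Linked _≥_ cs × HasCode π′ cs) →
         ∃ λ cs → All (1 ≤_) cs × Linked _≥_ cs × HasCode π cs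
  cons (cs , pos , link , h) with π ⟨$⟩ʳ 0F in π0≡ | largest≤ h
  ... | suc c | le = suc (toℕ c) ∷ cs , s≤s z≤n ∷ pos , Linked-∷ le link , cong toℕ π0≡ ∷ h
  -- A first entry 0 is not recorded: it forces the code of the rest to be empty, so `π` is the
  -- identity.
  cons (cs , 1≤c ∷ pos , link , h) | zero | le = contradiction (ℕ.≤-trans 1≤c le) λ ()
  cons ([] , [] , link , [] π′≈id) | zero | le = [] , [] , [] , [] λ where
    zero    → π0≡
    (suc i) → trans (punchIn-permute π 0F i) (cong₂ punchIn π0≡ (π′≈id i))

-- Counting permutations by their codes.

fixes-an-end : ∀ m (π : Permutation′ (suc m)) → Avoids2143 π → inversions π < m →
               π ⟨$⟩ʳ 0F ≡ 0F ⊎ π ⟨$⟩ʳ fromℕ m ≡ fromℕ m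
fixes-an-end m π av inv<m with π ⟨$⟩ʳ 0F Fin.≟ 0F | π ⟨$⟩ʳ fromℕ m Fin.≟ fromℕ m
... | yes π0≡0 | _              = inj₁ π0≡0
... | no _     | yes πlast≡last = inj₂ πlast≡last
... | no π0≢0  | no πlast≢last  =
  contradiction (avoids2143⇒inversions-≥ m π av π0≢0 πlast≢last) (ℕ.<⇒≱ inv<m)

module _ (k m : ℕ) (1≤k : 1 ≤ k) (k<m : k < m) where

  private
    patterns : List Pattern
    patterns = q1324 ∷ q2143 ∷ []

    Good : Permutation′ (suc m) → Set
    Good π = inversions π ≡ k × AvoidsAll patterns π

    good? : Decidable Good
    good? π = inversions π ℕ.≟ k ×-dec avoidsAll? patterns π

    good : List (Permutation′ (suc m))
    good = filter good? (permutations (suc m))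

    -- The two summands record whether the partition is the code of the
    -- permutation or that of its reverse-complement.
    codes : List (List ℕ ⊎ List ℕ)
    codes = map inj₁ (partitions k) ++ map inj₂ (partitions k)

    Coded : Permutation′ (suc m) → List ℕ ⊎ List ℕ → Set
    Coded π (inj₁ cs) = IsPartition k cs × HasCode π cs
    Coded π (inj₂ cs) = IsPartition k cs × HasCode (reverseComplement π) cs

    Coded-resp-≈ : ∀ {π ρ} c → π ≈ ρ → Coded π c → Coded ρ c
    Coded-resp-≈ {π} {ρ} (inj₁ _) eq (isP , h) = isP , HasCode-resp-≈ {π = π} {ρ} eq h
    Coded-resp-≈ {π} {ρ} (inj₂ _) eq (isP , h) =
      isP , HasCode-resp-≈ {ρ = reverseComplement ρ} (reverseComplement-cong {π = π} {ρ} eq) h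

    Coded-injective : ∀ {π ρ} c → Coded π c → Coded ρ c → π ≈ ρ
    Coded-injective         (inj₁ _) (_ , h) (_ , h′) = HasCode-injective h h′
    Coded-injective {π} {ρ} (inj₂ _) (_ , h) (_ , h′) =
      reverseComplement-injective {π = π} {ρ} (HasCode-injective h h′)

    -- The code of the reverse-complement has sum below `m`, so its last position is fixed and `π`
    -- fixes the first. The code of `π` itself is nonempty as `1 ≤ k`, and its first entry would be
    -- 0.
    Coded-disjoint : ∀ {π cs ds} → Coded π (inj₁ cs) → ¬ Coded π (inj₂ ds)
    Coded-disjoint {π} (isP , h) ((pos , _ , sum≡k) , h′) = nonzero isP h (opposite-injective (begin
      opposite (π ⟨$⟩ʳ 0F)              ≡⟨ cong (opposite ∘ (π ⟨$⟩ʳ_)) (Fin.opposite-involutive 0F) ⟨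
      reverseComplement π ⟨$⟩ʳ fromℕ m  ≡⟨ code⇒last h′ pos (subst (_< m) (sym sum≡k) k<m) ⟩
      fromℕ m                           ∎))
      where
      open ≡-Reasoning
      nonzero : ∀ {cs} → IsPartition k cs → HasCode π cs → π ⟨$⟩ʳ 0F ≢ 0F
      nonzero (_ , _ , 0≡k)    ([] _)     _    = ℕ.<⇒≢ 1≤k 0≡k
      nonzero (1≤c ∷ _ , _)    (refl ∷ _) π0≡0 = ℕ.>⇒≢ 1≤c (cong toℕ π0≡0)

    Coded-functional : ∀ {π} c d → Coded π c → Coded π d → c ≡ d
    Coded-functional (inj₁ _) (inj₁ _) ((pos , _) , h) ((pos′ , _) , h′) =
      cong inj₁ (HasCode-functional pos pos′ h h′)
    Coded-functional (inj₂ _) (inj₂ _) ((pos , _) , h) ((pos′ , _) , h′) =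
      cong inj₂ (HasCode-functional pos pos′ h h′)
    Coded-functional {π} (inj₁ _) (inj₂ _) h h′ = contradiction h′ (Coded-disjoint {π} h)
    Coded-functional {π} (inj₂ _) (inj₁ _) h h′ = contradiction h (Coded-disjoint {π} h′)

    good⇒coded : ∀ π → Good π → Any (Coded π) codes
    good⇒coded π (inv≡k , avoids1324 ∷ avoids2143 ∷ []) =
      cases (fixes-an-end m π (avoids-q2143 π avoids2143) (subst (_< m) (sym inv≡k) k<m))
      where
      partition-of : ∀ ρ → inversions ρ ≡ k → Avoids132 ρ →
                     ∃ λ cs → IsPartition k cs × HasCode ρ cs
      partition-of ρ inv≡k av = let cs , pos , link , h = avoids132⇒code ρ av in
        cs , (pos , link , trans (sym (inversions-code h)) inv≡k) , h

      cases : π ⟨$⟩ʳ 0F ≡ 0F ⊎ π ⟨$⟩ʳ fromℕ m ≡ fromℕ m → Any (Coded π) codes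
      cases (inj₂ πlast≡last) =
        let _ , isP , h = partition-of π inv≡k
              (avoids132-of-last π (avoids-q1324 π avoids1324) πlast≡last)
        in lose (∈-++⁺ˡ (∈-map⁺ inj₁ (partitions-complete isP))) (isP , h)
      cases (inj₁ π0≡0) =
        let _ , isP , h = partition-of (reverseComplement π)
              (trans (inversions-reverseComplement π) inv≡k)
              (avoids132-of-last (reverseComplement π)
                (avoids1324-reverseComplement π (avoids-q1324 π avoids1324))
                (trans (cong (λ i → opposite (π ⟨$⟩ʳ i)) (Fin.opposite-involutive 0F))
                       (cong opposite π0≡0)))
        in lose (∈-++⁺ʳ (map inj₁ (partitions k)) (∈-map⁺ inj₂ (partitions-complete isP))) (isP , h)

    coded⇒good : ∀ {π} c → Coded π c → Good π
    coded⇒good {π} (inj₁ _) ((_ , link , sum≡k) , h) =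
      trans (inversions-code h) sum≡k , avoids132⇒avoidsAll π (code⇒avoids132 h link)
    coded⇒good {π} (inj₂ _) ((_ , link , sum≡k) , h) =
      trans (sym (inversions-reverseComplement π)) (trans (inversions-code h) sum≡k) ,
      avoids132-reverseComplement⇒avoidsAll π (code⇒avoids132 h link)

    -- The list `permutations` contains `π` only up to pointwise equality, so the code is
    -- transferred to the listed representative.
    coded∈good : ∀ {π} c → Coded π c → Any (λ ρ → Coded ρ c) good
    coded∈good {π} c h =
      let ρ , ρ∈ , π≈ρ = find (permutations-complete π)
          h′ = Coded-resp-≈ {π} {ρ} c π≈ρ h
      in lose (∈-filter⁺ good? ρ∈ (coded⇒good {ρ} c h′)) h′

    -- A permutation with code `cs` serves the first summand and its reverse-complement the second,
    -- because the operation is an involution.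
    partition⇒coded : ∀ {cs} → cs ∈ partitions k →
                      ∃ (λ π → Coded π (inj₁ cs)) × ∃ (λ π → Coded π (inj₂ cs))
    partition⇒coded {cs} cs∈ = (π , isP , h) , (reverseComplement π , isP ,
      HasCode-resp-≈ {π = π} {reverseComplement (reverseComplement π)}
        (λ i → sym (reverseComplement-involutive π i)) h)
      where
      isP : IsPartition k cs
      isP = proj₂ (∈-filter⁻ (isPartition? k) {xs = listsUpTo k (upTo (suc k))} cs∈)

      coded : ∃ λ π → HasCode π cs
      coded = partition⇒code (suc m) (proj₁ isP)
        (subst (_≤ m) (sym (proj₂ (proj₂ isP))) (ℕ.<⇒≤ k<m))

      π = proj₁ coded
      h = proj₂ coded

    codes-unique : Unique codes
    codes-unique = ⊎-unique (partitions-unique k) (partitions-unique k)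

    codes⊆good : All (λ c → Any (λ π → Coded π c) good) codes
    codes⊆good = All.++⁺
      (All.map⁺ (All.tabulate λ cs∈ →
        let π , h = proj₁ (partition⇒coded cs∈) in coded∈good {π} (inj₁ _) h))
      (All.map⁺ (All.tabulate λ cs∈ →
        let π , h = proj₂ (partition⇒coded cs∈) in coded∈good {π} (inj₂ _) h))

    good⊆codes : All (λ π → Any (Coded π) codes) good
    good⊆codes = All.tabulate λ {π} π∈ →
      good⇒coded π (proj₂ (∈-filter⁻ good? {xs = permutations (suc m)} π∈))

    length-codes : length codes ≡ 2 * p k
    length-codes = begin
      length codes                      ≡⟨ length-++ (map inj₁ (partitions k)) ⟩
      length (map inj₁ (partitions k)) + length (map inj₂ (partitions k))
                                        ≡⟨ cong₂ _+_ (length-map inj₁ (partitions k))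
                                                    (length-map inj₂ (partitions k)) ⟩
      p k + p k                         ≡⟨ cong (p k +_) (ℕ.+-identityʳ (p k)) ⟨
      2 * p k                           ∎
      where open ≡-Reasoning

  -- `Coded` matches good permutations with `codes`: each side always has a partner and no partner
  -- is shared, so `pigeonhole` applies in both directions.
  av-patterns : av (suc m) k patterns ≡ 2 * p k
  av-patterns = trans
    (ℕ.≤-antisym
      (pigeonhole Coded
        (AllPairs.map (λ {π} {ρ} π≉ρ c h h′ → π≉ρ (Coded-injective {π} {ρ} c h h′))
          (AllPairs.filter⁺ good? (permutations-unique (suc m))))
        good⊆codes)
      (pigeonhole (flip Coded)
        (AllPairs.map (λ {c} {d} c≢d π h h′ → c≢d (Coded-functional {π} c d h h′)) codes-unique)
        codes⊆good))
    length-codes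

proposition5p6 : ∀ (k n : ℕ) → 1 ≤ k → k + 2 ≤ n → av n k (q1324 ∷ q2143 ∷ []) ≡ 2 * p k
proposition5p6 k zero    1≤k k+2≤0 = contradiction (ℕ.m+n≤o⇒n≤o k k+2≤0) λ ()
-- For permutations of size `suc n` the hypothesis `k + 2 ≤ suc n` amounts to `k < n`.
proposition5p6 k (suc n) 1≤k k+2≤1+n =
  av-patterns k n 1≤k (ℕ.s≤s⁻¹ (subst (_≤ suc n) (ℕ.+-comm k 2) k+2≤1+n))
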